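{- Let $f$ be a formula such that at least one of the following holds: (i) $ABCA.ABA.ACA\preceq f\preceq ABCA.ABA.ACA.ACB.CBA$; (ii) $ABCA.ABA.BCB.AC\preceq f\preceq ABCA.ABA.ABCBA.ACB$; (iii) $ABCA.ABA.BCB.CBA\preceq f\preceq ABCA.ABA.ABCBA.ACB$. Then every ternary recurrent infinite word avoiding $f$ is equivalent to $b_3$, $\sigma(b_3)$, or $\sigma^2(b_3)$.
   Context: A formula is a finite set of non-empty words over variables $A,B,C,\dots$ (fragments), written separated by dots. An occurrence of a formula $f$ in a word $w$ is a non-erasing morphism $h$ from variables to non-empty words such that $h(\phi)$ is a factor of $w$ for every fragment $\phi$ of $f$; $w$ avoids $f$ if it has no occurrence. $g\preceq f$ means there is a non-erasing morphism $h$ such that the $h$-image of every fragment of $g$ is a factor of some fragment of $f$. An infinite word is recurrent if each of its finite factors occurs infinitely often; two infinite words are equivalent if they have the same set of finite factors. On $\Sigma_3=\{0,1,2\}$, $\sigma$ is the morphism $0\mapsto1,1\mapsto2,2\mapsto0$, and $b_3$ is the fixed point starting with $0$ of the morphism $0\mapsto 012,\ 1\mapsto 02,\ 2\mapsto 1$. -}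

module Defs where

open import Data.Nat using (ℕ; zero; suc; _+_; _<_)
open import Data.Fin using (Fin; zero; suc)
open import Data.List using (List; []; _∷_; _++_; concatMap; map; upTo; length; lookup)
open import Data.List.NonEmpty using (List⁺; _∷_; toList)
open import Data.List.Membership.Propositional using (_∈_)
open import Data.Product using (Σ; ∃; ∃-syntax; _×_; _,_)
open import Data.Sum using (_⊎_)
open import Relation.Binary.PropositionalEquality using (_≡_)
open import Relation.Nullary using (¬_)
open import Function.Bundles using (_⇔_)

-- Formulas.  Variables are natural numbers (A = 0, B = 1, C = 2, ...).
-- A fragment is a non-empty word over the variables; a formula is a
-- finite set of fragments, represented by a list.

Var : Set
Var = ℕ

Fragment : Set
Fragment = List⁺ Var

Formula : Set
Formula = List Fragment

image : {X Y : Set} → (X → List⁺ Y) → List X → List Y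
image h xs = concatMap (λ x → toList (h x)) xs

FactorOf : {A : Set} → List A → List A → Set
FactorOf u v = ∃[ p ] ∃[ s ] (p ++ u ++ s ≡ v)

_⪯_ : Formula → Formula → Set
g ⪯ f = Σ (Var → List⁺ Var) λ h → ((φ : Fragment) → φ ∈ g →
          ∃[ ψ ] (ψ ∈ f × FactorOf (image h (toList φ)) (toList ψ)))

Σ₃ : Set
Σ₃ = Fin 3

InfWord : Set
InfWord = ℕ → Σ₃

segment : InfWord → ℕ → ℕ → List Σ₃
segment w i n = map (λ k → w (i + k)) (upTo n)

FactorInf : List Σ₃ → InfWord → Set
FactorInf u w = ∃[ i ] (segment w i (length u) ≡ u)

Occurrence : Formula → InfWord → (Var → List⁺ Σ₃) → Set
Occurrence f w h = (φ : Fragment) → φ ∈ f → FactorInf (image h (toList φ)) w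

Avoids : InfWord → Formula → Set
Avoids w f = ¬ (Σ (Var → List⁺ Σ₃) λ h → Occurrence f w h)

Recurrent : InfWord → Set
Recurrent w = (i n m : ℕ) → ∃[ j ] (m < j × segment w j n ≡ segment w i n)

Equivalent : InfWord → InfWord → Set
Equivalent w w' = (u : List Σ₃) → FactorInf u w ⇔ FactorInf u w'

σ : Σ₃ → Σ₃
σ zero = suc zero
σ (suc zero) = suc (suc zero)
σ (suc (suc zero)) = zero

μ : Σ₃ → List Σ₃
μ zero = zero ∷ suc zero ∷ suc (suc zero) ∷ []
μ (suc zero) = zero ∷ suc (suc zero) ∷ []
μ (suc (suc zero)) = suc zero ∷ []

μ* : List Σ₃ → List Σ₃
μ* = concatMap μ

iterμ : ℕ → List Σ₃
iterμ zero = zero ∷ []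
iterμ (suc k) = μ* (iterμ k)

lookupD : List Σ₃ → ℕ → Σ₃
lookupD [] _ = zero
lookupD (x ∷ xs) zero = x
lookupD (x ∷ xs) (suc n) = lookupD xs n

-- b₃ : the fixed point of μ starting with 0.  μ^k(0) is a prefix of
-- μ^(k+1)(0) and has length ≥ k+1, so position n is read off μ^(n+1)(0).
b₃ : InfWord
b₃ n = lookupD (iterμ (suc n)) n

A B C : Var
A = 0
B = 1
C = 2

F₁ : Formula
F₁ = (A ∷ B ∷ C ∷ A ∷ []) ∷ (A ∷ B ∷ A ∷ []) ∷ (A ∷ C ∷ A ∷ []) ∷ []

F₁' : Formula
F₁' = (A ∷ B ∷ C ∷ A ∷ []) ∷ (A ∷ B ∷ A ∷ []) ∷ (A ∷ C ∷ A ∷ [])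
    ∷ (A ∷ C ∷ B ∷ []) ∷ (C ∷ B ∷ A ∷ []) ∷ []

F₂ : Formula
F₂ = (A ∷ B ∷ C ∷ A ∷ []) ∷ (A ∷ B ∷ A ∷ []) ∷ (B ∷ C ∷ B ∷ []) ∷ (A ∷ C ∷ []) ∷ []

F₃ : Formula
F₃ = (A ∷ B ∷ C ∷ A ∷ []) ∷ (A ∷ B ∷ A ∷ []) ∷ (B ∷ C ∷ B ∷ []) ∷ (C ∷ B ∷ A ∷ []) ∷ []

F₂₃' : Formula
F₂₃' = (A ∷ B ∷ C ∷ A ∷ []) ∷ (A ∷ B ∷ A ∷ []) ∷ (A ∷ B ∷ C ∷ B ∷ A ∷ [])
     ∷ (A ∷ C ∷ B ∷ []) ∷ []

{-# OPTIONS --safe #-}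

-- Since f ⪯ F₁' or f ⪯ F₂₃', w avoids F₁' or F₂₃'.  Such a recurrent w is square-free, and a
-- finite backtracking using only squares and occurrences that send variables to letters shows that
-- every factor of length 30 avoids 010 and 212 up to a power of σ, the same power along all of w.
-- After rotation, w avoids squares, 010 and 212, hence is, up to a prefix, the image under μ of a
-- word with the same properties.  Iterating, w contains μᵏ(0) for all k, and by recurrence each of
-- its factors lies in some μᵏ(ab) with a ≠ b; both describe the factors of b₃.

module Submission where

open import Defs
open import Data.Bool using (Bool; true; false; _∧_; _∨_; T)
open import Data.Bool.ListAction using (any; all)
open import Data.Bool.Properties using (T-≡; T-∨)
open import Data.Empty using (⊥-elim)
open import Data.Nat using (ℕ; zero; suc; _+_; _∸_; _≤_; _<_; z≤n; s≤s)
open import Data.Nat.Properties using (+-suc; +-comm; +-assoc; +-identityʳ; +-mono-≤; +-monoˡ-≤; +-monoʳ-≤; ≤-refl; ≤-reflexive; ≤-trans; <⇒≤; n≤1+n; m≤n+m; m∸n+n≡m; m≤n⇒m<n∨m≡n; m≤n⇒∃[o]m+o≡n)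
open import Data.Fin using (zero; suc; _≟_)
open import Data.Fin.Properties using (any?; all?)
open import Data.List using (List; []; _∷_; _++_; map; concatMap; upTo; applyUpTo; allFin; length; take; drop)
open import Data.List.NonEmpty using (List⁺; _∷_; toList; _⁺++⁺_)
open import Data.List.Properties using (++-monoid; length-++; concatMap-++; take++drop≡id; map-++; map-∘; map-id; map-cong; map-upTo)
open import Data.List.Membership.Propositional using (_∈_)
open import Data.List.Membership.Propositional.Properties using (∈-allFin)
open import Data.List.Relation.Unary.All as All using ()
open import Data.List.Relation.Unary.All.Properties using (all⁺)
open import Data.List.Relation.Unary.Any as Any using (here; there)
open import Data.List.Relation.Unary.Any.Properties using (any⁻)
open import Data.List.Relation.Binary.Prefix.Heterogeneous using ([]; _∷_)
open import Data.List.Relation.Binary.Infix.Heterogeneous using (Infix; here; there; _ⁱ++_)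
open import Data.List.Relation.Binary.Infix.Heterogeneous.Properties using (infix?)
open import Data.Product using (∃; ∃-syntax; _×_; _,_; proj₁; proj₂)
open import Data.Sum using (_⊎_; inj₁; inj₂)
open import Function using (_∘_)
open import Function.Bundles using (mk⇔; Equivalence)
open import Relation.Nullary using (¬_; Dec; yes; does; contradiction; ¬?; _×-dec_; _→-dec_)
open import Relation.Binary.PropositionalEquality
open import Tactic.MonoidSolver using (solve)

pattern 𝟎 = zero
pattern 𝟏 = suc zero
pattern 𝟐 = suc (suc zero)

-- Reading finite words in infinite words

-- Inductive, unlike `FactorInf`, so that matching on a reading yields one equation per letter.
data Reads (w : InfWord) : ℕ → List Σ₃ → Set where
  []  : ∀ {i} → Reads w i []
  _∷_ : ∀ {i x u} → w i ≡ x → Reads w (suc i) u → Reads w i (x ∷ u)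

reads-at : ∀ {w i j u} → i ≡ j → Reads w i u → Reads w j u
reads-at refl r = r

reads-++ : ∀ {w i} u {v} → Reads w i u → Reads w (length u + i) v → Reads w i (u ++ v)
reads-++ [] [] s = s
reads-++ (x ∷ u) (e ∷ r) s =
  e ∷ reads-++ u r (reads-at (sym (+-suc (length u) _)) s)

reads-++ˡ : ∀ {w i} u {v} → Reads w i (u ++ v) → Reads w i u
reads-++ˡ [] r = []
reads-++ˡ (x ∷ u) (e ∷ r) = e ∷ reads-++ˡ u r

reads-++ʳ : ∀ {w i} u {v} → Reads w i (u ++ v) → Reads w (length u + i) v
reads-++ʳ [] r = r
reads-++ʳ (x ∷ u) (e ∷ r) = reads-at (+-suc (length u) _) (reads-++ʳ u r)

reads-FactorOf : ∀ {w i u v} → FactorOf u v → Reads w i v → ∃[ j ] Reads w j u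
reads-FactorOf {u = u} (p , s , refl) r = _ , reads-++ˡ u (reads-++ʳ p r)

reads-map : ∀ {w i u} (f : Σ₃ → Σ₃) → Reads w i u → Reads (f ∘ w) i (map f u)
reads-map f [] = []
reads-map f (e ∷ r) = cong f e ∷ reads-map f r

reads-cong : ∀ {w w′ i u} → (∀ k → w k ≡ w′ k) → Reads w i u → Reads w′ i u
reads-cong h [] = []
reads-cong h (e ∷ r) = trans (sym (h _)) e ∷ reads-cong h r

window : InfWord → ℕ → ℕ → List Σ₃
window w i zero = []
window w i (suc n) = w i ∷ window w (suc i) n

reads-window : ∀ {w} i n → Reads w i (window w i n)
reads-window i zero = []
reads-window i (suc n) = refl ∷ reads-window (suc i) n

reads⇒window : ∀ {w i u} → Reads w i u → window w i (length u) ≡ u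
reads⇒window [] = refl
reads⇒window (e ∷ r) = cong₂ _∷_ e (reads⇒window r)

applyUpTo-window : ∀ {w i} f n → (∀ k → f k ≡ w (i + k)) → applyUpTo f n ≡ window w i n
applyUpTo-window f zero h = refl
applyUpTo-window {w} {i} f (suc n) h =
  cong₂ _∷_ (trans (h 0) (cong w (+-identityʳ i)))
            (applyUpTo-window (f ∘ suc) n (λ k → trans (h (suc k)) (cong w (+-suc i k))))

segment≡window : ∀ w i n → segment w i n ≡ window w i n
segment≡window w i n = trans (map-upTo _ n) (applyUpTo-window _ n (λ _ → refl))

reads⇒FactorInf : ∀ {w i u} → Reads w i u → FactorInf u w
reads⇒FactorInf {w} {i} {u} r = i , trans (segment≡window w i (length u)) (reads⇒window r)

FactorInf⇒reads : ∀ {w u} → FactorInf u w → ∃[ i ] Reads w i u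
FactorInf⇒reads {w} {u} (i , e) =
  i , subst (Reads w i) (trans (sym (segment≡window w i (length u))) e) (reads-window i (length u))

reads-recur : ∀ {w i u} → Recurrent w → Reads w i u → ∀ m → ∃[ j ] (m < j × Reads w j u)
reads-recur {w} {i} {u} rec r m with rec i (length u) m
... | j , m<j , e = j , m<j , subst (Reads w j)
  (trans (sym (segment≡window w j _)) (trans e (trans (segment≡window w i _) (reads⇒window r))))
  (reads-window j (length u))

reads-prefix : ∀ {w i} u v → Reads w i v → Reads w i u → length u ≤ length v → ∃[ s ] (u ++ s ≡ v)
reads-prefix [] v _ _ _ = v , refl
reads-prefix (x ∷ u) (y ∷ v) (e′ ∷ r′) (e ∷ r) (s≤s le) with reads-prefix u v r′ r le
... | s , refl = s , cong (_∷ v) (trans (sym e) e′)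

reads-within : ∀ {w p} r u v → Reads w p v → Reads w (r + p) u → r + length u ≤ length v → FactorOf u v
reads-within zero u v rv ru le = [] , reads-prefix u v rv ru le
reads-within (suc r) u (y ∷ v) (_ ∷ rv) ru (s≤s le)
  with reads-within r u v rv (reads-at (sym (+-suc r _)) ru) le
... | p , s , refl = y ∷ p , s , refl

shift : InfWord → ℕ → InfWord
shift w s k = w (k + s)

reads-shift⁻ : ∀ {w s i u} → Reads (shift w s) i u → Reads w (i + s) u
reads-shift⁻ [] = []
reads-shift⁻ (e ∷ r) = e ∷ reads-shift⁻ r

reads-shift⁺ : ∀ {w s i u} → Reads w (i + s) u → Reads (shift w s) i u
reads-shift⁺ [] = []
reads-shift⁺ (e ∷ r) = e ∷ reads-shift⁺ r

-- Iterates of μ and prefixes of b₃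

iter : ℕ → List Σ₃ → List Σ₃
iter zero u = u
iter (suc k) u = μ* (iter k u)

μ*-++ : ∀ u v → μ* (u ++ v) ≡ μ* u ++ μ* v
μ*-++ = concatMap-++ μ

μ*-FactorOf : ∀ {u v} → FactorOf u v → FactorOf (μ* u) (μ* v)
μ*-FactorOf {u} (p , s , refl) =
  μ* p , μ* s , sym (trans (μ*-++ p (u ++ s)) (cong (μ* p ++_) (μ*-++ u s)))

iter-FactorOf : ∀ k {u v} → FactorOf u v → FactorOf (iter k u) (iter k v)
iter-FactorOf zero f = f
iter-FactorOf (suc k) f = μ*-FactorOf (iter-FactorOf k f)

iter-++ : ∀ k u v → iter k (u ++ v) ≡ iter k u ++ iter k v
iter-++ zero u v = refl
iter-++ (suc k) u v = trans (cong μ* (iter-++ k u v)) (μ*-++ (iter k u) (iter k v))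

-- `iter` adds `μ` on the outside; induction on the image of a single letter needs it on the inside.
iter-μ* : ∀ k u → iter k (μ* u) ≡ iter (suc k) u
iter-μ* zero u = refl
iter-μ* (suc k) u = cong μ* (iter-μ* k u)

iter-iterμ : ∀ k m → iter k (iterμ m) ≡ iterμ (k + m)
iter-iterμ zero m = refl
iter-iterμ (suc k) m = cong μ* (iter-iterμ k m)

length-μ* : ∀ u → length u ≤ length (μ* u)
length-μ* [] = z≤n
length-μ* (x ∷ u) = ≤-trans (s≤s (length-μ* u))
  (≤-trans (+-monoˡ-≤ _ (1≤μ x)) (≤-reflexive (sym (length-++ (μ x)))))
  where
  1≤μ : ∀ x → 1 ≤ length (μ x)
  1≤μ 𝟎 = s≤s z≤n
  1≤μ 𝟏 = s≤s z≤n
  1≤μ 𝟐 = s≤s z≤n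

length-iter : ∀ k u → length u ≤ length (iter k u)
length-iter zero u = ≤-refl
length-iter (suc k) u = ≤-trans (length-iter k u) (length-μ* (iter k u))

power : ℕ → Σ₃ → List Σ₃
power k a = iter k (a ∷ [])

length-iter-∷ : ∀ {n} k a u → n ≤ length (power k a) → n + length u ≤ length (iter k (a ∷ u))
length-iter-∷ k a u le = ≤-trans (+-mono-≤ le (length-iter k u))
  (≤-reflexive (sym (trans (cong length (iter-++ k (a ∷ []) u)) (length-++ (power k a)))))

-- The letter 2 is one iteration behind, since μ 2 is a single letter.
weight : Σ₃ → ℕ
weight 𝟎 = 1
weight 𝟏 = 1
weight 𝟐 = 0

weight+k≤length-power : ∀ k a → weight a + k ≤ length (power k a)
weight+k≤length-power zero 𝟎 = ≤-refl
weight+k≤length-power zero 𝟏 = ≤-refl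
weight+k≤length-power zero 𝟐 = z≤n
weight+k≤length-power (suc k) a = subst (λ u → weight a + suc k ≤ length u) (iter-μ* k (a ∷ [])) (bound a)
  where
  bound : ∀ a → weight a + suc k ≤ length (iter k (μ* (a ∷ [])))
  bound 𝟎 = ≤-trans (≤-trans (≤-reflexive (+-comm 1 (suc k))) (+-monoʳ-≤ (suc k) (s≤s z≤n)))
                    (length-iter-∷ k 𝟎 (𝟏 ∷ 𝟐 ∷ []) (weight+k≤length-power k 𝟎))
  bound 𝟏 = ≤-trans (≤-reflexive (+-comm 1 (suc k)))
                    (length-iter-∷ k 𝟎 (𝟐 ∷ []) (weight+k≤length-power k 𝟎))
  -- `μ 𝟐` is the letter 𝟏, and `weight 𝟐 + suc k` equals `weight 𝟏 + k`.
  bound 𝟐 = weight+k≤length-power k 𝟏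

k≤length-power : ∀ k a → k ≤ length (power k a)
k≤length-power k a = ≤-trans (m≤n+m k (weight a)) (weight+k≤length-power k a)

power-𝟎 : ∀ k → power k 𝟎 ≡ iterμ k
power-𝟎 k = trans (iter-iterμ k 0) (cong iterμ (+-identityʳ k))

k<length-iterμ : ∀ k → k < length (iterμ k)
k<length-iterμ k = subst (λ u → k < length u) (power-𝟎 k) (weight+k≤length-power k 𝟎)

-- `iterμ d` begins with 𝟎; applying `iter k` to this gives the prefix.
iterμ-prefix : ∀ d k → ∃[ s ] (iterμ k ++ s ≡ iterμ (d + k))
iterμ-prefix d k = iter k (proj₁ (prefix₀ d)) ,
  (begin
    iterμ k ++ iter k (proj₁ (prefix₀ d))             ≡⟨ cong (_++ iter k (proj₁ (prefix₀ d))) (sym (power-𝟎 k)) ⟩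
    power k 𝟎 ++ iter k (proj₁ (prefix₀ d))           ≡⟨ sym (iter-++ k (𝟎 ∷ []) (proj₁ (prefix₀ d))) ⟩
    iter k (𝟎 ∷ proj₁ (prefix₀ d))                    ≡⟨ cong (iter k) (proj₂ (prefix₀ d)) ⟩
    iter k (iterμ d)                                  ≡⟨ iter-iterμ k d ⟩
    iterμ (k + d)                                     ≡⟨ cong iterμ (+-comm k d) ⟩
    iterμ (d + k)                                     ∎)
  where
  open ≡-Reasoning
  prefix₀ : ∀ d → ∃[ s ] (𝟎 ∷ s ≡ iterμ d)
  prefix₀ zero = [] , refl
  prefix₀ (suc d) with prefix₀ d
  ... | s , e = _ , cong μ* e

lookupD-++ : ∀ u v n → n < length u → lookupD (u ++ v) n ≡ lookupD u n
lookupD-++ (x ∷ u) v zero _ = refl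
lookupD-++ (x ∷ u) v (suc n) (s≤s lt) = lookupD-++ u v n lt

-- `iterμ (suc n)` and `iterμ k` are both prefixes of `iterμ (k + suc n)`, and n is a position
-- inside each of them, so the default value of `lookupD` is never read.
b₃-lookup : ∀ k n → n < length (iterμ k) → b₃ n ≡ lookupD (iterμ k) n
b₃-lookup k n lt with iterμ-prefix k (suc n) | iterμ-prefix (suc n) k
... | s , e | s′ , e′ = begin
  lookupD (iterμ (suc n)) n              ≡⟨ sym (lookupD-++ (iterμ (suc n)) s n (≤-trans (n≤1+n _) (k<length-iterμ (suc n)))) ⟩
  lookupD (iterμ (suc n) ++ s) n         ≡⟨ cong (λ u → lookupD u n) (trans e (trans (cong iterμ (+-comm k (suc n))) (sym e′))) ⟩
  lookupD (iterμ k ++ s′) n              ≡⟨ lookupD-++ (iterμ k) s′ n lt ⟩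
  lookupD (iterμ k) n                    ∎
  where open ≡-Reasoning

reads-lookupD : ∀ {w} i u → (∀ n → n < length u → w (n + i) ≡ lookupD u n) → Reads w i u
reads-lookupD i [] h = []
reads-lookupD {w} i (x ∷ u) h =
  h 0 (s≤s z≤n) ∷ reads-lookupD (suc i) u (λ n lt → trans (cong w (+-suc n i)) (h (suc n) (s≤s lt)))

reads-b₃ : ∀ k → Reads b₃ 0 (iterμ k)
reads-b₃ k = reads-lookupD 0 (iterμ k) (λ n lt → trans (cong b₃ (+-identityʳ n)) (b₃-lookup k n lt))

b₃-factor : ∀ {i u} → Reads b₃ i u → ∃[ k ] FactorOf u (iterμ k)
b₃-factor {i} {u} r = i + length u ,
  reads-within i u _ (reads-b₃ (i + length u)) (reads-at (sym (+-identityʳ i)) r)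
    (<⇒≤ (k<length-iterμ (i + length u)))

-- Desubstitution

SquareFree : InfWord → Set
SquareFree w = ∀ {i} x u → ¬ Reads w i ((x ∷ u) ++ (x ∷ u))

record Tame (w : InfWord) : Set where
  field
    squareFree : SquareFree w
    no-010 : ∀ {i} → ¬ Reads w i (𝟎 ∷ 𝟏 ∷ 𝟎 ∷ [])
    no-212 : ∀ {i} → ¬ Reads w i (𝟐 ∷ 𝟏 ∷ 𝟐 ∷ [])

  adjacent : ∀ {i x} → w i ≡ x → w (suc i) ≡ x → {A : Set} → A
  adjacent e e′ = contradiction (e ∷ e′ ∷ []) (squareFree _ [])

tame-shift : ∀ {w} s → Tame w → Tame (shift w s)
tame-shift {w} s t = record
  { squareFree = λ x u r → squareFree x u (reads-shift⁻ {w} r)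
  ; no-010 = λ r → no-010 (reads-shift⁻ {w} r)
  ; no-212 = λ r → no-212 (reads-shift⁻ {w} r)
  } where open Tame t

-- A square-free word without 𝟎 alternates 𝟏 and 𝟐, so it would begin with 2121, which contains 212,
-- or with the square 1212.
first-𝟎 : ∀ {w} → Tame w → ∃[ s ] (w s ≡ 𝟎)
first-𝟎 {w} t with w 0 in e₀ | w 1 in e₁ | w 2 in e₂ | w 3 in e₃
... | 𝟎 | _ | _ | _ = 0 , e₀
... | _ | 𝟎 | _ | _ = 1 , e₁
... | _ | _ | 𝟎 | _ = 2 , e₂
... | _ | _ | _ | 𝟎 = 3 , e₃
... | 𝟏 | 𝟏 | _ | _ = Tame.adjacent t e₀ e₁
... | 𝟐 | 𝟐 | _ | _ = Tame.adjacent t e₀ e₁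
... | _ | 𝟏 | 𝟏 | _ = Tame.adjacent t e₁ e₂
... | _ | 𝟐 | 𝟐 | _ = Tame.adjacent t e₁ e₂
... | 𝟐 | 𝟏 | 𝟐 | _ = contradiction (e₀ ∷ e₁ ∷ e₂ ∷ []) (Tame.no-212 t)
... | 𝟏 | 𝟐 | 𝟏 | 𝟏 = Tame.adjacent t e₂ e₃
... | 𝟏 | 𝟐 | 𝟏 | 𝟐 = contradiction (e₀ ∷ e₁ ∷ e₂ ∷ e₃ ∷ []) (Tame.squareFree t 𝟏 (𝟐 ∷ []))

-- From `pos 0` on, `w` is the concatenation of the blocks `m (w′ k)`. A general `m` covers all
-- powers of `μ`, and `pos 0` is left free so that initial blocks can be discarded.
record Parse (m : Σ₃ → List Σ₃) (w w′ : InfWord) : Set where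
  field
    pos : ℕ → ℕ
    reads : ∀ k → Reads w (pos k) (m (w′ k))
    step : ∀ k → pos (suc k) ≡ length (m (w′ k)) + pos k

  lift : ∀ {j u} → Reads w′ j u →
         Reads w (pos j) (concatMap m u) × pos (length u + j) ≡ length (concatMap m u) + pos j
  lift [] = [] , refl
  lift {j} {x ∷ u} (refl ∷ r) with lift r
  ... | ru , eu =
    reads-++ (m x) (reads j) (reads-at (step j) ru) ,
    (begin
      pos (suc (length u + j))                               ≡⟨ cong pos (sym (+-suc (length u) j)) ⟩
      pos (length u + suc j)                                 ≡⟨ eu ⟩
      length (concatMap m u) + pos (suc j)                   ≡⟨ cong (length (concatMap m u) +_) (step j) ⟩
      length (concatMap m u) + (length (m x) + pos j)        ≡⟨ sym (+-assoc (length (concatMap m u)) _ _) ⟩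
      length (concatMap m u) + length (m x) + pos j          ≡⟨ cong (_+ pos j) (+-comm (length (concatMap m u)) _) ⟩
      length (m x) + length (concatMap m u) + pos j          ≡⟨ cong (_+ pos j) (sym (length-++ (m x))) ⟩
      length (m x ++ concatMap m u) + pos j                  ∎)
    where open ≡-Reasoning

  locate : (∀ a → 0 < length (m a)) → ∀ d →
           ∃[ q ] ∃[ r ] (d + pos 0 ≡ r + pos q × r < length (m (w′ q)))
  locate 0<m zero = 0 , 0 , refl , 0<m _
  locate 0<m (suc d) with locate 0<m d
  ... | q , r , e , lt with m≤n⇒m<n∨m≡n lt
  ... | inj₁ lt′ = q , suc r , cong suc e , lt′
  -- The current block is exhausted; the next one is non-empty, so offset 0 lies in it.
  ... | inj₂ e′ = suc q , 0 , trans (cong suc e) (trans (cong (_+ pos q) e′) (sym (step q))) , 0<m _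

parse-shift : ∀ {m w w′} s → Parse m w w′ → Parse m w (shift w′ s)
parse-shift s p = record { pos = λ k → pos (k + s) ; reads = λ k → reads (k + s) ; step = λ k → step (k + s) }
  where open Parse p

parse-∘ : ∀ {m w w′ w″} → Parse μ w w′ → Parse m w′ w″ → Parse (μ* ∘ m) w w″
parse-∘ p p′ = record
  { pos = pos p ∘ pos p′
  ; reads = λ k → proj₁ (lift p (reads p′ k))
  ; step = λ k → trans (cong (pos p) (step p′ k)) (proj₂ (lift p (reads p′ k)))
  } where open Parse

-- A block of μ starts at each 0 and at each 1 preceded by 2.
data Start (w : InfWord) : ℕ → Set where
  at-𝟎 : ∀ {p} → w p ≡ 𝟎 → Start w p
  at-𝟐𝟏 : ∀ {p} → w p ≡ 𝟐 → w (suc p) ≡ 𝟏 → Start w (suc p)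

-- Preimages of tame words under `μ`

module Desubstitution {w : InfWord} (tame : Tame w) where
  open Tame tame

  start-after-𝟐 : ∀ {p} → w p ≡ 𝟐 → Start w (suc p)
  start-after-𝟐 {p} e with w (suc p) in e′
  ... | 𝟎 = at-𝟎 e′
  ... | 𝟏 = at-𝟐𝟏 e e′
  ... | 𝟐 = adjacent e e′

  -- From 𝟎, excluding squares and 010 leaves only 02 and 012; after 21, excluding squares and 212
  -- leaves only 𝟎. Each time the next block starts right after.
  block : ∀ {p} → Start w p → ∃[ a ] (Reads w p (μ a) × Start w (length (μ a) + p))
  block {p} (at-𝟎 e) with w (suc p) in e₁ | w (2 + p) in e₂
  ... | 𝟎 | _ = adjacent e e₁
  ... | 𝟐 | _ = 𝟏 , e ∷ e₁ ∷ [] , start-after-𝟐 e₁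
  ... | 𝟏 | 𝟎 = contradiction (e ∷ e₁ ∷ e₂ ∷ []) no-010
  ... | 𝟏 | 𝟏 = adjacent e₁ e₂
  ... | 𝟏 | 𝟐 = 𝟎 , e ∷ e₁ ∷ e₂ ∷ [] , start-after-𝟐 e₂
  block (at-𝟐𝟏 {p} e e₁) with w (2 + p) in e₂
  ... | 𝟎 = 𝟐 , e₁ ∷ [] , at-𝟎 e₂
  ... | 𝟏 = adjacent e₁ e₂
  ... | 𝟐 = contradiction (e ∷ e₁ ∷ e₂ ∷ []) no-212

  -- 1021 is the image of 212. Blocks starting at both of its ends force a 𝟐 before it and a 𝟎 after
  -- it, which gives the square 210210.
  no-1021 : ∀ {p} → Start w p → Reads w p (𝟏 ∷ 𝟎 ∷ 𝟐 ∷ 𝟏 ∷ []) → ¬ Start w (4 + p)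
  no-1021 (at-𝟎 e) (e₁ ∷ _) _ with () ← trans (sym e) e₁
  no-1021 (at-𝟐𝟏 _ _) (_ ∷ _ ∷ _ ∷ e₄ ∷ []) (at-𝟐𝟏 e′ _) with () ← trans (sym e′) e₄
  no-1021 (at-𝟐𝟏 e₀ _) (e₁ ∷ e₂ ∷ e₃ ∷ e₄ ∷ []) (at-𝟎 e₅) =
    squareFree 𝟐 (𝟏 ∷ 𝟎 ∷ []) (e₀ ∷ e₁ ∷ e₂ ∷ e₃ ∷ e₄ ∷ e₅ ∷ [])

  module _ (w0≡𝟎 : w 0 ≡ 𝟎) where

    start : ℕ → ∃ (Start w)
    start zero = 0 , at-𝟎 w0≡𝟎
    start (suc k) = _ , proj₂ (proj₂ (block (proj₂ (start k))))

    preimage : InfWord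
    preimage k = proj₁ (block (proj₂ (start k)))

    parse : Parse μ w preimage
    parse = record
      { pos = proj₁ ∘ start
      ; reads = λ k → proj₁ (proj₂ (block (proj₂ (start k))))
      ; step = λ k → refl
      }

    open Parse parse

    -- `μ` sends squares to squares; splitting on the first letter exposes the image of the root as
    -- a non-empty list.
    preimage-squareFree : SquareFree preimage
    preimage-squareFree x u r with subst (Reads w _) (μ*-++ (x ∷ u) (x ∷ u)) (proj₁ (lift r))
    preimage-squareFree 𝟎 u r | r′ = squareFree 𝟎 (𝟏 ∷ 𝟐 ∷ μ* u) r′
    preimage-squareFree 𝟏 u r | r′ = squareFree 𝟎 (𝟐 ∷ μ* u) r′
    preimage-squareFree 𝟐 u r | r′ = squareFree 𝟏 (μ* u) r′

    preimage-tame : Tame preimage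
    preimage-tame = record
      { squareFree = preimage-squareFree
      ; no-010 = λ r → case-010 (proj₁ (lift r))
      ; no-212 = λ {i} r → no-1021 (proj₂ (start i)) (proj₁ (lift r))
                                   (subst (Start w) (proj₂ (lift r)) (proj₂ (start (3 + i))))
      }
      where
      case-010 : ∀ {i} → ¬ Reads w i (𝟎 ∷ 𝟏 ∷ 𝟐 ∷ 𝟎 ∷ 𝟐 ∷ 𝟎 ∷ 𝟏 ∷ 𝟐 ∷ [])
      -- The image of 010 is 01202012, whose middle four letters form the square 2020.
      case-010 (_ ∷ _ ∷ a ∷ b ∷ c ∷ d ∷ _) = squareFree 𝟐 (𝟎 ∷ []) (a ∷ b ∷ c ∷ d ∷ [])

-- Each round drops the letters of the preimage before its first 𝟎, which restores the hypothesis
-- `w 0 ≡ 𝟎` for the next round; the parses compose to one by a power of `μ`.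
desubstitute : ∀ k {w} → Tame w → w 0 ≡ 𝟎 → ∃[ w′ ] (Tame w′ × w′ 0 ≡ 𝟎 × Parse (power k) w w′)
desubstitute zero {w} t z = w , t , z , record { pos = λ k → k ; reads = λ k → refl ∷ [] ; step = λ k → refl }
desubstitute (suc k) t z with first-𝟎 (Desubstitution.preimage-tame t z)
... | s , z′ with desubstitute k (tame-shift s (Desubstitution.preimage-tame t z)) z′
... | w′ , t′ , z″ , p = w′ , t′ , z″ , parse-∘ (parse-shift s (Desubstitution.parse t z)) p

-- Equality of the factor sets of `b₃` and of recurrent tame words

pair-FactorOf-iterμ : ∀ {a b} → a ≢ b → FactorOf (a ∷ b ∷ []) (iterμ 3)
-- `iterμ 3` is 012021012102; the six pairs of distinct letters occur at its positions 0 to 5.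
pair-FactorOf-iterμ {𝟎} {𝟏} _ = [] , _ , refl
pair-FactorOf-iterμ {𝟎} {𝟐} _ = 𝟎 ∷ 𝟏 ∷ 𝟐 ∷ [] , _ , refl
pair-FactorOf-iterμ {𝟏} {𝟎} _ = 𝟎 ∷ 𝟏 ∷ 𝟐 ∷ 𝟎 ∷ 𝟐 ∷ [] , _ , refl
pair-FactorOf-iterμ {𝟏} {𝟐} _ = 𝟎 ∷ [] , _ , refl
pair-FactorOf-iterμ {𝟐} {𝟎} _ = 𝟎 ∷ 𝟏 ∷ [] , _ , refl
pair-FactorOf-iterμ {𝟐} {𝟏} _ = 𝟎 ∷ 𝟏 ∷ 𝟐 ∷ 𝟎 ∷ [] , _ , refl
pair-FactorOf-iterμ {𝟎} {𝟎} a≢b = contradiction refl a≢b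
pair-FactorOf-iterμ {𝟏} {𝟏} a≢b = contradiction refl a≢b
pair-FactorOf-iterμ {𝟐} {𝟐} a≢b = contradiction refl a≢b

concatMap-power : ∀ k u → concatMap (power k) u ≡ iter k u
concatMap-power k [] = sym (iter-[] k)
  where
  iter-[] : ∀ k → iter k [] ≡ []
  iter-[] zero = refl
  iter-[] (suc k) = cong μ* (iter-[] k)
concatMap-power k (a ∷ u) = trans (cong (power k a ++_) (concatMap-power k u)) (sym (iter-++ k (a ∷ []) u))

tame-equivalent-b₃ : ∀ {w} → Recurrent w → Tame w → Equivalent w b₃
tame-equivalent-b₃ {w} rec t u with first-𝟎 t
... | s , z = mk⇔ forth back
  where
  back : FactorInf u b₃ → FactorInf u w
  back f with b₃-factor (proj₂ (FactorInf⇒reads f))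
  ... | k , fac with desubstitute k (tame-shift s t) z
  ... | w′ , _ , z′ , p = reads⇒FactorInf (proj₂ (reads-FactorOf fac (reads-shift⁻ {w} prefix)))
    where
    prefix : Reads (shift w s) (Parse.pos p 0) (iterμ k)
    prefix = subst (Reads _ _) (trans (cong (power k) z′) (power-𝟎 k)) (Parse.reads p 0)

  forth : FactorInf u w → FactorInf u b₃
  -- With exponent `length u`, each block is at least as long as u, so an occurrence of u starting
  -- inside a block fits into it and the next one.
  forth f with desubstitute (length u) (tame-shift s t) z
  -- Recurrence moves the occurrence past the start of the first block.
  ... | w′ , t′ , _ , p with reads-recur rec (proj₂ (FactorInf⇒reads f)) (Parse.pos p 0 + s)
  ... | j , lt , r with Parse.locate p (λ a → length-iter k (a ∷ [])) (j ∸ (Parse.pos p 0 + s))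
    where k = length u
  ... | q , o , e , o< = reads⇒FactorInf (proj₂
      (reads-FactorOf u-in-X (proj₂ (reads-FactorOf X-in-b₃ (reads-b₃ (k + 3))))))
    where
    open Parse p
    k = length u
    X = iter k (w′ q ∷ w′ (suc q) ∷ [])

    j-split : j ≡ o + pos q + s
    j-split = trans (sym (m∸n+n≡m (<⇒≤ lt)))
      (trans (sym (+-assoc (j ∸ (pos 0 + s)) (pos 0) s)) (cong (_+ s) e))

    bound : o + k ≤ length X
    bound = ≤-trans (+-mono-≤ (<⇒≤ o<) (k≤length-power k (w′ (suc q))))
      (≤-reflexive (sym (trans (cong length (iter-++ k (w′ q ∷ []) (w′ (suc q) ∷ [])))
                               (length-++ (power k (w′ q))))))

    u-in-X : FactorOf u X
    u-in-X = reads-within o u X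
      (subst (Reads (shift w s) (pos q)) (concatMap-power k (w′ q ∷ w′ (suc q) ∷ []))
        (proj₁ (lift (refl ∷ refl ∷ []))))
      (reads-shift⁺ {w} (reads-at j-split r)) bound

    X-in-b₃ : FactorOf X (iterμ (k + 3))
    -- Consecutive letters of the square-free word `w′` differ, so their two blocks form a factor of
    -- `iter k (iterμ 3)`.
    X-in-b₃ = subst (FactorOf X) (iter-iterμ k 3)
      (iter-FactorOf k (pair-FactorOf-iterμ (λ e → Tame.adjacent t′ refl (sym e))))

-- Occurrences of formulas

image-++ : ∀ {X Y : Set} (h : X → List⁺ Y) u v → image h (u ++ v) ≡ image h u ++ image h v
image-++ h = concatMap-++ (λ x → toList (h x))

image⁺ : ∀ {X Y : Set} → (X → List⁺ Y) → List⁺ X → List⁺ Y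
image⁺ h (x ∷ u) with h x
... | y ∷ v = y ∷ v ++ image h u

toList-image⁺ : ∀ {X Y : Set} (h : X → List⁺ Y) u → toList (image⁺ h u) ≡ image h (toList u)
toList-image⁺ h (x ∷ u) = refl

image-∘ : ∀ {X Y Z : Set} (h : Y → List⁺ Z) (g : X → List⁺ Y) u →
          image (image⁺ h ∘ g) u ≡ image h (image g u)
image-∘ h g [] = refl
image-∘ h g (x ∷ u) = trans (cong₂ _++_ (toList-image⁺ h (g x)) (image-∘ h g u))
                            (sym (image-++ h (toList (g x)) (image g u)))

image-FactorOf : ∀ {X Y : Set} (h : X → List⁺ Y) {u v} → FactorOf u v → FactorOf (image h u) (image h v)
image-FactorOf h {u} (p , s , refl) = image h p , image h s ,
  sym (trans (image-++ h p (u ++ s)) (cong (image h p ++_) (image-++ h u s)))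

-- An occurrence of `g` composed with the morphism witnessing `f ⪯ g` is an occurrence of `f`.
avoids-⪯ : ∀ {w f g} → f ⪯ g → Avoids w f → Avoids w g
avoids-⪯ {w} (g , embeds) avoids (h , occurs) = avoids (image⁺ h ∘ g , λ φ φ∈f →
  let ψ , ψ∈g , factor = embeds φ φ∈f
      _ , r = FactorInf⇒reads {w} (occurs ψ ψ∈g)
  in subst (λ u → FactorInf u w) (sym (image-∘ h g (toList φ)))
       (reads⇒FactorInf (proj₂ (reads-FactorOf (image-FactorOf h factor) r))))

-- Square-freeness from avoidance

length-window : ∀ w i n → length (window w i n) ≡ n
length-window w i zero = refl
length-window w i (suc n) = cong suc (length-window w (suc i) n)

reads-recur-gap : ∀ {w i u} → Recurrent w → Reads w i u → ∃[ z ] Reads w i (u ++ toList z ++ u)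
-- `length u + i` is the first position after u; the strict bound makes the gap non-empty.
reads-recur-gap {w} {i} {u} rec r with reads-recur rec r (length u + i)
... | j , lt , r′ with m≤n⇒∃[o]m+o≡n lt
... | o , refl = w m ∷ window w (suc m) o ,
  reads-++ u r (reads-++ (window w m (suc o)) (reads-window m (suc o)) (reads-at position r′))
  where
  m = length u + i
  position : suc (m + o) ≡ suc (length (window w (suc m) o) + m)
  position = cong suc (trans (+-comm m o) (cong (_+ m) (sym (length-window w (suc m) o))))

-- If uu is a factor then so is uu z uu y uu z uu for some z and y, and it contains every fragment
-- under A ↦ u, B ↦ uzu, C ↦ uyu.
square-morphism : List⁺ Σ₃ → List⁺ Σ₃ → List⁺ Σ₃ → Var → List⁺ Σ₃
square-morphism u z y 0 = u
square-morphism u z y 1 = u ⁺++⁺ (z ⁺++⁺ u)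
square-morphism u z y _ = u ⁺++⁺ (y ⁺++⁺ u)

-- Over plain lists each factor claim is an equation for the monoid solver; the trailing `[]` come
-- from `concatMap`.
module SquareFrame (u z y : List Σ₃) where

  frame : List Σ₃
  frame = ((u ++ u) ++ z ++ (u ++ u)) ++ y ++ ((u ++ u) ++ z ++ (u ++ u))

  ABCA-factor : FactorOf (u ++ (u ++ z ++ u) ++ (u ++ y ++ u) ++ u ++ []) frame
  ABCA-factor = [] , z ++ u ++ u , solve (++-monoid Σ₃)

  ABA-factor : FactorOf (u ++ (u ++ z ++ u) ++ u ++ []) frame
  ABA-factor = [] , y ++ u ++ u ++ z ++ u ++ u , solve (++-monoid Σ₃)

  ACA-factor : FactorOf (u ++ (u ++ y ++ u) ++ u ++ []) frame
  ACA-factor = u ++ u ++ z , z ++ u ++ u , solve (++-monoid Σ₃)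

  ACB-factor : FactorOf (u ++ (u ++ y ++ u) ++ (u ++ z ++ u) ++ []) frame
  ACB-factor = u ++ u ++ z , u , solve (++-monoid Σ₃)

  CBA-factor : FactorOf ((u ++ y ++ u) ++ (u ++ z ++ u) ++ u ++ []) frame
  CBA-factor = u ++ u ++ z ++ u , [] , solve (++-monoid Σ₃)

  ABCBA-factor : FactorOf (u ++ (u ++ z ++ u) ++ (u ++ y ++ u) ++ (u ++ z ++ u) ++ u ++ []) frame
  ABCBA-factor = [] , [] , solve (++-monoid Σ₃)

SquareOccurrence : Formula → Set
SquareOccurrence F = ∀ u z y φ → φ ∈ F →
  FactorOf (image (square-morphism u z y) (toList φ)) (SquareFrame.frame (toList u) (toList z) (toList y))

squareOccurrence₁ : SquareOccurrence F₁'
squareOccurrence₁ u z y = factor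
  where
  open SquareFrame (toList u) (toList z) (toList y)
  factor : ∀ φ → φ ∈ F₁' → FactorOf (image (square-morphism u z y) (toList φ)) frame
  factor _ (here refl) = ABCA-factor
  factor _ (there (here refl)) = ABA-factor
  factor _ (there (there (here refl))) = ACA-factor
  factor _ (there (there (there (here refl)))) = ACB-factor
  factor _ (there (there (there (there (here refl))))) = CBA-factor

squareOccurrence₂₃ : SquareOccurrence F₂₃'
squareOccurrence₂₃ u z y = factor
  where
  open SquareFrame (toList u) (toList z) (toList y)
  factor : ∀ φ → φ ∈ F₂₃' → FactorOf (image (square-morphism u z y) (toList φ)) frame
  factor _ (here refl) = ABCA-factor
  factor _ (there (here refl)) = ABA-factor
  factor _ (there (there (here refl))) = ABCBA-factor
  factor _ (there (there (there (here refl)))) = ACB-factor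

avoids⇒squareFree : ∀ {w F} → SquareOccurrence F → Recurrent w → Avoids w F → SquareFree w
avoids⇒squareFree occurs rec avoids x u r with reads-recur-gap rec r
-- The second return is that of the whole word made of two copies of the square around z.
... | z , r′ with reads-recur-gap rec r′
... | y , r″ = avoids (square-morphism (x ∷ u) z y , λ φ φ∈F →
  reads⇒FactorInf (proj₂ (reads-FactorOf (occurs (x ∷ u) z y φ φ∈F) r″)))

-- Backtracking

-- Boolean, since such tests run at every node of the search; soundness lemmas recover their
-- meaning.
prefixᵇ : List Σ₃ → List Σ₃ → Bool
prefixᵇ [] _ = true
prefixᵇ (_ ∷ _) [] = false
prefixᵇ (x ∷ u) (y ∷ v) = does (x ≟ y) ∧ prefixᵇ u v

infixᵇ : List Σ₃ → List Σ₃ → Bool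
infixᵇ u [] = prefixᵇ u []
infixᵇ u v@(_ ∷ v′) = prefixᵇ u v ∨ infixᵇ u v′

-- Only words of length at most 30 are tested, hence the bound 15 on the period.
squarePrefixᵇ : List Σ₃ → Bool
squarePrefixᵇ [] = false
squarePrefixᵇ (x ∷ u) = any (λ l → prefixᵇ (x ∷ take l u) (drop l u)) (upTo 15)

letters : Σ₃ × Σ₃ × Σ₃ → Var → List⁺ Σ₃
letters (a , b , c) 0 = a ∷ []
letters (a , b , c) 1 = b ∷ []
letters (a , b , c) _ = c ∷ []

-- In `ABCA` any two distinct variables are adjacent somewhere, so a non-injective choice of letters
-- would create a square.
permutations : List (Σ₃ × Σ₃ × Σ₃)
permutations = (𝟎 , 𝟏 , 𝟐) ∷ (𝟎 , 𝟐 , 𝟏) ∷ (𝟏 , 𝟎 , 𝟐) ∷ (𝟏 , 𝟐 , 𝟎) ∷ (𝟐 , 𝟎 , 𝟏) ∷ (𝟐 , 𝟏 , 𝟎) ∷ []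

letterOccurrenceᵇ : Formula → List Σ₃ → Bool
letterOccurrenceᵇ F u =
  any (λ abc → all (λ φ → infixᵇ (image (letters abc) (toList φ)) u) F) permutations

Clean : List Σ₃ → Set
Clean u = ¬ Infix _≡_ (𝟎 ∷ 𝟏 ∷ 𝟎 ∷ []) u × ¬ Infix _≡_ (𝟐 ∷ 𝟏 ∷ 𝟐 ∷ []) u

clean? : ∀ u → Dec (Clean u)
clean? u = ¬? (infix? _≟_ _ u) ×-dec ¬? (infix? _≟_ _ u)

-- Powers of `σ` and their inverses, the latter written as powers too because `σ` has order 3.
rotate unrotate : Σ₃ → Σ₃ → Σ₃
rotate 𝟎 x = x
rotate 𝟏 x = σ x
rotate 𝟐 x = σ (σ x)
unrotate 𝟎 x = x
unrotate 𝟏 x = σ (σ x)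
unrotate 𝟐 x = σ x

-- Uniqueness is asked of the tail, the part shared with the next window.
Oriented : List Σ₃ → Set
Oriented u = ∃[ t ] (Clean (map (unrotate t) u) × (∀ s → Clean (map (unrotate s) (drop 1 u)) → s ≡ t))

oriented? : ∀ u → Dec (Oriented u)
oriented? u = any? λ t → clean? (map (unrotate t) u) ×-dec
              all? (λ s → clean? (map (unrotate s) (drop 1 u)) →-dec (s ≟ t))

-- Words are extended to the left, so that a newly created square is a prefix.
forced : Formula → ℕ → List Σ₃ → Bool
forced F zero u = does (oriented? u)
forced F (suc n) u =
  all (λ x → squarePrefixᵇ (x ∷ u) ∨ letterOccurrenceᵇ F (x ∷ u) ∨ forced F n (x ∷ u)) (allFin 3)

-- Soundness of the search

reads-prefixᵇ : ∀ {w i} u v → T (prefixᵇ u v) → Reads w i v → Reads w i u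
reads-prefixᵇ [] v _ _ = []
reads-prefixᵇ (x ∷ u) (y ∷ v) p (e ∷ r) with x ≟ y
... | yes refl = e ∷ reads-prefixᵇ u v p r

reads-infixᵇ : ∀ {w i} u v → T (infixᵇ u v) → Reads w i v → ∃[ j ] Reads w j u
reads-infixᵇ u [] p r = _ , reads-prefixᵇ u [] p r
reads-infixᵇ u v@(_ ∷ v′) p (e ∷ r) with Equivalence.to (T-∨ {prefixᵇ u v}) p
... | inj₁ q = _ , reads-prefixᵇ u v q (e ∷ r)
... | inj₂ q = reads-infixᵇ u v′ q r

squarePrefixᵇ-sound : ∀ {w i} u → T (squarePrefixᵇ u) → Reads w i u → ¬ SquareFree w
squarePrefixᵇ-sound {w} (x ∷ u) p r squareFree with Any.satisfied (any⁻ _ (upTo 15) p)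
... | l , q = squareFree x (take l u)
  (reads-++ root (reads-++ˡ root r′) (reads-prefixᵇ root (drop l u) q (reads-++ʳ root r′)))
  where
  root = x ∷ take l u
  r′ : Reads w _ (root ++ drop l u)
  r′ = subst (Reads w _) (cong (x ∷_) (sym (take++drop≡id l u))) r

letterOccurrenceᵇ-sound : ∀ {w i} F u → T (letterOccurrenceᵇ F u) → Reads w i u → ¬ Avoids w F
letterOccurrenceᵇ-sound F u p r avoids with Any.satisfied (any⁻ _ permutations p)
... | abc , q = avoids (letters abc , λ φ φ∈F →
  reads⇒FactorInf (proj₂ (reads-infixᵇ _ u (All.lookup (all⁺ _ F q) φ∈F) r)))

dec-witness : {P : Set} (P? : Dec P) → T (does P?) → P
dec-witness (yes p) _ = p

-- The search is followed along the letters of `w`, with `n` letters still to be added on the left;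
-- this branch can be closed neither by a square nor by an occurrence.
forced-sound : ∀ {w F} → SquareFree w → Avoids w F →
               ∀ n m i → T (forced F n (window w (n + i) m)) → Oriented (window w i (n + m))
forced-sound {w} squareFree avoids zero m i p = dec-witness (oriented? (window w i m)) p
forced-sound {w} {F} squareFree avoids (suc n) m i p
  with Equivalence.to (T-∨ {squarePrefixᵇ (window w (n + i) (suc m))})
         (All.lookup (all⁺ branch (allFin 3) p) (∈-allFin (w (n + i))))
  where
  branch : Σ₃ → Bool
  branch x = let u = x ∷ window w (suc n + i) m in squarePrefixᵇ u ∨ letterOccurrenceᵇ F u ∨ forced F n u
... | inj₁ q = ⊥-elim (squarePrefixᵇ-sound _ q (reads-window (n + i) (suc m)) squareFree)
... | inj₂ q with Equivalence.to (T-∨ {letterOccurrenceᵇ F (window w (n + i) (suc m))}) q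
... | inj₁ q′ = ⊥-elim (letterOccurrenceᵇ-sound F _ q′ (reads-window (n + i) (suc m)) avoids)
... | inj₂ q′ = subst (λ k → Oriented (window w i k)) (+-suc n m) (forced-sound squareFree avoids n (suc m) i q′)

windows-oriented : ∀ {w F} n → forced F n [] ≡ true → SquareFree w → Avoids w F →
                   ∀ i → Oriented (window w i n)
windows-oriented {w} n e squareFree avoids i = subst (λ k → Oriented (window w i k)) (+-identityʳ n)
  (forced-sound squareFree avoids n 0 i (Equivalence.from T-≡ e))

-- Constancy of the orientation

window-∷ʳ : ∀ w i n → window w i (suc n) ≡ window w i n ++ w (n + i) ∷ []
window-∷ʳ w i zero = refl
window-∷ʳ w i (suc n) = cong (w i ∷_)
  (trans (window-∷ʳ w (suc i) n) (cong (λ k → window w (suc i) n ++ w k ∷ []) (+-suc n i)))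

clean-++ˡ : ∀ {u} v → Clean (u ++ v) → Clean u
clean-++ˡ v (c , d) = (λ i → c (i ⁱ++ v)) , (λ i → d (i ⁱ++ v))

-- A window without its last letter is the part shared with the preceding window, where uniqueness
-- of the orientation applies.
clean-window : ∀ {w} f i n → Clean (map f (window w i (suc n))) → Clean (map f (window w i n))
clean-window {w} f i n c = clean-++ˡ _
  (subst Clean (trans (cong (map f) (window-∷ʳ w i n)) (map-++ f (window w i n) _)) c)

-- Consecutive windows share all but one letter, so the orientation cannot change along w.
orientation-constant : ∀ {w} n → (∀ i → Oriented (window w i (suc n))) →
                       ∃[ t ] (∀ i → Clean (map (unrotate t) (window w i (suc n))))
orientation-constant {w} n oriented = proj₁ (oriented 0) , λ i →
  subst (λ t → Clean (map (unrotate t) (window w i (suc n)))) (constant i) (proj₁ (proj₂ (oriented i)))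
  where
  constant : ∀ i → proj₁ (oriented i) ≡ proj₁ (oriented 0)
  constant zero = refl
  constant (suc i) = trans
    (proj₂ (proj₂ (oriented i)) _ (clean-window _ (suc i) n (proj₁ (proj₂ (oriented (suc i))))))
    (constant i)

-- Rotating the alphabet

rotate-unrotate : ∀ t x → rotate t (unrotate t x) ≡ x
rotate-unrotate 𝟎 x = refl
rotate-unrotate 𝟏 𝟎 = refl
rotate-unrotate 𝟏 𝟏 = refl
rotate-unrotate 𝟏 𝟐 = refl
rotate-unrotate 𝟐 𝟎 = refl
rotate-unrotate 𝟐 𝟏 = refl
rotate-unrotate 𝟐 𝟐 = refl

unrotate-rotate : ∀ t x → unrotate t (rotate t x) ≡ x
unrotate-rotate 𝟎 x = refl
unrotate-rotate 𝟏 𝟎 = refl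
unrotate-rotate 𝟏 𝟏 = refl
unrotate-rotate 𝟏 𝟐 = refl
unrotate-rotate 𝟐 𝟎 = refl
unrotate-rotate 𝟐 𝟏 = refl
unrotate-rotate 𝟐 𝟐 = refl

recurrent-map : ∀ {w} f → Recurrent w → Recurrent (f ∘ w)
recurrent-map f rec i n m with rec i n m
... | j , m<j , e = j , m<j , trans (map-∘ (upTo n)) (trans (cong (map f) e) (sym (map-∘ (upTo n))))

squareFree-map : ∀ {w} f g → (∀ x → g (f x) ≡ x) → SquareFree w → SquareFree (f ∘ w)
squareFree-map {w} f g gf squareFree x u r = squareFree (g x) (map g u)
  (subst (Reads w _) (map-++ g (x ∷ u) (x ∷ u)) (reads-cong (λ k → gf (w k)) (reads-map g r)))

map-inverse : ∀ (f g : Σ₃ → Σ₃) → (∀ x → g (f x) ≡ x) → ∀ u → map g (map f u) ≡ u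
map-inverse f g gf u = trans (sym (map-∘ u)) (trans (map-cong gf u) (map-id u))

factor-map : ∀ {w u} f → FactorInf u w → FactorInf (map f u) (f ∘ w)
factor-map {w} f occurs = reads⇒FactorInf (reads-map f (proj₂ (FactorInf⇒reads {w} occurs)))

factor-unmap : ∀ {w u} f g → (∀ x → g (f x) ≡ x) → FactorInf (map f u) (f ∘ w) → FactorInf u w
factor-unmap {w} {u} f g gf occurs = subst (λ v → FactorInf v w)
  (map-inverse f g gf u)
  (reads⇒FactorInf (reads-cong (λ k → gf (w k)) (reads-map g (proj₂ (FactorInf⇒reads {f ∘ w} occurs)))))

-- u is a factor of `w` iff `map f u` is one of `f ∘ w`, hence of `v`, iff u is one of `g ∘ v`.
equivalent-map : ∀ {w v} f g → (∀ x → g (f x) ≡ x) → (∀ x → f (g x) ≡ x) →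
                 Equivalent (f ∘ w) v → Equivalent w (g ∘ v)
equivalent-map {w} {v} f g gf fg eqv u = mk⇔
  (λ o → subst (λ u → FactorInf u (g ∘ v)) (map-inverse f g gf u)
           (factor-map {v} g (Equivalence.to (eqv (map f u)) (factor-map {w} f o))))
  (λ o → factor-unmap {w} f g gf (Equivalence.from (eqv (map f u))
           (factor-unmap {v} g f fg (subst (λ u → FactorInf u (g ∘ v))
             (sym (map-inverse f g gf u)) o))))

-- A forbidden word has three letters, so if read at i it is a prefix of the window at i, which has
-- at least three.
clean⇒tame : ∀ {w} t n → SquareFree w → (∀ i → Clean (map (unrotate t) (window w i (3 + n)))) →
             Tame (unrotate t ∘ w)
clean⇒tame t n squareFree clean = record
  { squareFree = squareFree-map (unrotate t) (rotate t) (rotate-unrotate t) squareFree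
  ; no-010 = λ { {i} (e₀ ∷ e₁ ∷ e₂ ∷ []) → proj₁ (clean i) (here (sym e₀ ∷ sym e₁ ∷ sym e₂ ∷ [])) }
  ; no-212 = λ { {i} (e₀ ∷ e₁ ∷ e₂ ∷ []) → proj₂ (clean i) (here (sym e₀ ∷ sym e₁ ∷ sym e₂ ∷ [])) }
  }

-- Hiding the search depth keeps the search from being run again when the certificates are used.
record Backtracking (F : Formula) : Set where
  field
    depth : ℕ
    succeeds : forced F (3 + depth) [] ≡ true

-- Checking `refl` runs the search down to words of length 3 + 27 = 30.
backtracking₁ : Backtracking F₁'
backtracking₁ = record { depth = 27 ; succeeds = refl }

backtracking₂₃ : Backtracking F₂₃'
backtracking₂₃ = record { depth = 27 ; succeeds = refl }

avoids⇒equivalent : ∀ {w F} → SquareOccurrence F → Backtracking F → Recurrent w → Avoids w F →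
                    ∃[ t ] Equivalent w (rotate t ∘ b₃)
avoids⇒equivalent {w} {F} occurs search rec avoids =
  let t , clean = orientation-constant (2 + depth) (windows-oriented (3 + depth) succeeds squareFree avoids)
  in t , equivalent-map {w} {b₃} (unrotate t) (rotate t) (rotate-unrotate t) (unrotate-rotate t)
           (tame-equivalent-b₃ (recurrent-map {w} (unrotate t) rec) (clean⇒tame t depth squareFree clean))
  where
  open Backtracking search
  squareFree : SquareFree w
  squareFree = avoids⇒squareFree {w} {F} occurs rec avoids

theorem10 : (f : Formula) →
    ((F₁ ⪯ f × f ⪯ F₁') ⊎ (F₂ ⪯ f × f ⪯ F₂₃') ⊎ (F₃ ⪯ f × f ⪯ F₂₃')) →
    (w : InfWord) → Recurrent w → Avoids w f →
    Equivalent w b₃ ⊎ Equivalent w (λ n → σ (b₃ n)) ⊎ Equivalent w (λ n → σ (σ (b₃ n)))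
theorem10 f between w rec avoids = cases (equivalent between)
  where
  equivalent : (F₁ ⪯ f × f ⪯ F₁') ⊎ (F₂ ⪯ f × f ⪯ F₂₃') ⊎ (F₃ ⪯ f × f ⪯ F₂₃') →
               ∃[ t ] Equivalent w (rotate t ∘ b₃)
  equivalent (inj₁ (_ , f⪯)) =
    avoids⇒equivalent {w} squareOccurrence₁ backtracking₁ rec (avoids-⪯ {w} {f} {F₁'} f⪯ avoids)
  equivalent (inj₂ (inj₁ (_ , f⪯))) =
    avoids⇒equivalent {w} squareOccurrence₂₃ backtracking₂₃ rec (avoids-⪯ {w} {f} {F₂₃'} f⪯ avoids)
  equivalent (inj₂ (inj₂ (_ , f⪯))) =
    avoids⇒equivalent {w} squareOccurrence₂₃ backtracking₂₃ rec (avoids-⪯ {w} {f} {F₂₃'} f⪯ avoids)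

  cases : ∃[ t ] Equivalent w (rotate t ∘ b₃) →
          Equivalent w b₃ ⊎ Equivalent w (λ n → σ (b₃ n)) ⊎ Equivalent w (λ n → σ (σ (b₃ n)))
  cases (𝟎 , e) = inj₁ e
  cases (𝟏 , e) = inj₂ (inj₁ e)
  cases (𝟐 , e) = inj₂ (inj₂ e)
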